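{- Let $M\in\mathbb F_2^{n\times n}$ be a symmetric matrix and let $u\in\mathbb F_2^n$. If $u=0$, then $\operatorname{null}(M+uu^T)=\operatorname{null}(M)$. Assume $u\neq 0$. Then: (1) If $u\notin\operatorname{Im}(M)$, then \[ \operatorname{null}(M+uu^T)=\operatorname{null}(M)-1\quad\text{and}\quad \operatorname{rank}(M+uu^T)=\operatorname{rank}(M)+1 . \] (2) If $u\in\operatorname{Im}(M)$, choose $y\in\mathbb F_2^n$ with $My=u$. Then the scalar $u^Ty\in\mathbb F_2$ is independent of the choice of $y$, and \[ \operatorname{null}(M+uu^T)=\begin{cases}\operatorname{null}(M), & u^Ty=0,\\ \operatorname{null}(M)+1, & u^Ty=1,\end{cases} \] equivalently \[ \operatorname{rank}(M+uu^T)=\begin{cases}\operatorname{rank}(M), & u^Ty=0,\\ \operatorname{rank}(M)-1, & u^Ty=1.\end{cases} \]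
   Context: All matrices and vector spaces are over the two-element field $\mathbb F_2$. $\operatorname{Im}(M)$ denotes the column space of $M$ and $\operatorname{null}(M)=\dim\ker(M)$. -}

module Defs where

open import Data.Nat.Base using (ℕ; zero; suc)
open import Data.Parity.Base using (Parity; 0ℙ; 1ℙ; _+_; _*_)
import Data.Parity.Properties as ℙ
open import Data.List.Base as List using (List; []; _∷_; _++_)
open import Data.List.Membership.Propositional using () renaming (_∈_ to _∈ˡ_)
open import Data.List.Membership.Propositional.Properties
  using (∈-map⁺; ∈-++⁺ˡ; ∈-++⁺ʳ)
open import Data.List.Relation.Unary.Any as Any using (here; there)
open import Data.Product.Base using (∃; _×_; _,_; proj₁)
open import Data.Vec.Base using (Vec; []; _∷_; foldr′; map; replicate; tail; transpose; zipWith)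
open import Data.Vec.Properties
  using (≡-dec; zipWith-identityˡ; zipWith-identityʳ; map-id; map-const)
open import Data.Vec.Relation.Unary.All using (All; []; _∷_)
open import Relation.Binary.PropositionalEquality
  using (_≡_; refl; sym; trans; cong; cong₂)
open import Relation.Nullary.Decidable using (Dec; yes; no; map′)
open import Relation.Nullary.Negation using (contradiction)
open import Relation.Unary using (Pred; Decidable; _∈_; _∉_; _⊆_)
open import Level using (0ℓ)

-- The ring ℤ/2ℤ, i.e. the field with two elements.
𝔽₂ : Set
𝔽₂ = Parity

𝔽₂^_ : ℕ → Set
𝔽₂^ n = Vec 𝔽₂ n

-- A matrix is the vector of its rows.
Matrix : ℕ → ℕ → Set
Matrix m n = Vec (𝔽₂^ n) m

private
  variable
    k m n : ℕ

infixl 6 _+ᵛ_ _+ᴹ_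
infixr 7 _*ᵛ_ _·_ _⊗_ _*ᴹ_
infix  8 𝔽₂^_
infix  4 _≟ᵛ_

0ᵛ : 𝔽₂^ n
0ᵛ = replicate _ 0ℙ

_+ᵛ_ : 𝔽₂^ n → 𝔽₂^ n → 𝔽₂^ n
_+ᵛ_ = zipWith _+_

_*ᵛ_ : 𝔽₂ → 𝔽₂^ n → 𝔽₂^ n
a *ᵛ v = map (a *_) v

-- The scalar uᵀv.
_·_ : 𝔽₂^ n → 𝔽₂^ n → 𝔽₂
u · v = foldr′ _+_ 0ℙ (zipWith _*_ u v)

-- The matrix uvᵀ, with entries uᵢvⱼ.
_⊗_ : 𝔽₂^ m → 𝔽₂^ n → Matrix m n
u ⊗ v = map (_*ᵛ v) u

_+ᴹ_ : Matrix m n → Matrix m n → Matrix m n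
_+ᴹ_ = zipWith _+ᵛ_

_*ᴹ_ : Matrix m n → 𝔽₂^ n → 𝔽₂^ m
M *ᴹ v = map (_· v) M

Symmetric : Matrix n n → Set
Symmetric M = transpose M ≡ M

Ker : Matrix m n → Pred (𝔽₂^ n) 0ℓ
Ker M v = M *ᴹ v ≡ 0ᵛ

-- M *ᴹ y is the combination of the columns of M with coefficients y.
Im : Matrix m n → Pred (𝔽₂^ m) 0ℓ
Im M v = ∃ λ y → M *ᴹ y ≡ v

linearCombination : 𝔽₂^ k → Vec (𝔽₂^ n) k → 𝔽₂^ n
linearCombination c vs = foldr′ _+ᵛ_ 0ᵛ (zipWith _*ᵛ_ c vs)

Span : Vec (𝔽₂^ n) k → Pred (𝔽₂^ n) 0ℓ
Span vs v = ∃ λ c → linearCombination c vs ≡ v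

LinearlyIndependent : Vec (𝔽₂^ n) k → Set
LinearlyIndependent vs = ∀ c → linearCombination c vs ≡ 0ᵛ → c ≡ 0ᵛ

-- Meant for S a linear subspace, for which the first and last fields say that
-- vs spans exactly S.
record IsBasis (S : Pred (𝔽₂^ n) 0ℓ) (vs : Vec (𝔽₂^ n) k) : Set where
  field
    members     : All S vs
    independent : LinearlyIndependent vs
    spanning    : S ⊆ Span vs

_≟ᵛ_ : (u v : 𝔽₂^ n) → Dec (u ≡ v)
_≟ᵛ_ = ≡-dec ℙ._≟_

allVectors : ∀ n → List (𝔽₂^ n)
allVectors zero    = [] ∷ []
allVectors (suc n) =
  List.map (0ℙ ∷_) (allVectors n) ++ List.map (1ℙ ∷_) (allVectors n)

∈-allVectors : (v : 𝔽₂^ n) → v ∈ˡ allVectors n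
∈-allVectors []       = here refl
∈-allVectors (0ℙ ∷ v) = ∈-++⁺ˡ (∈-map⁺ (0ℙ ∷_) (∈-allVectors v))
∈-allVectors (1ℙ ∷ v) = ∈-++⁺ʳ _ (∈-map⁺ (1ℙ ∷_) (∈-allVectors v))

∃? : {P : Pred (𝔽₂^ n) 0ℓ} → Decidable P → Dec (∃ P)
∃? {n = n} P? = map′ Any.satisfied
  (λ { (v , p) → Any.map (λ { refl → p }) (∈-allVectors v) })
  (Any.any? P? (allVectors n))

Ker? : (M : Matrix m n) → Decidable (Ker M)
Ker? M v = (M *ᴹ v) ≟ᵛ 0ᵛ

Im? : (M : Matrix m n) → Decidable (Im M)
Im? M v = ∃? λ y → (M *ᴹ y) ≟ᵛ v

Span? : (vs : Vec (𝔽₂^ n) k) → Decidable (Span vs)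
Span? vs v = ∃? λ c → linearCombination c vs ≟ᵛ v

+ᵛ-identityˡ : (v : 𝔽₂^ n) → 0ᵛ +ᵛ v ≡ v
+ᵛ-identityˡ = zipWith-identityˡ ℙ.+-identityˡ

+ᵛ-identityʳ : (v : 𝔽₂^ n) → v +ᵛ 0ᵛ ≡ v
+ᵛ-identityʳ = zipWith-identityʳ ℙ.+-identityʳ

0*ᵛ : (v : 𝔽₂^ n) → 0ℙ *ᵛ v ≡ 0ᵛ
0*ᵛ v = map-const v 0ℙ

1*ᵛ : (v : 𝔽₂^ n) → 1ℙ *ᵛ v ≡ v
1*ᵛ = map-id

+ᵛ≡0⇒≡ : (u v : 𝔽₂^ n) → u +ᵛ v ≡ 0ᵛ → v ≡ u
+ᵛ≡0⇒≡ []       []       _  = refl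
+ᵛ≡0⇒≡ (0ℙ ∷ u) (0ℙ ∷ v) eq = cong (0ℙ ∷_) (+ᵛ≡0⇒≡ u v (cong tail eq))
+ᵛ≡0⇒≡ (1ℙ ∷ u) (1ℙ ∷ v) eq = cong (1ℙ ∷_) (+ᵛ≡0⇒≡ u v (cong tail eq))

linearCombination-0∷ : (c : 𝔽₂^ k) (v : 𝔽₂^ n) (vs : Vec (𝔽₂^ n) k) →
  linearCombination (0ℙ ∷ c) (v ∷ vs) ≡ linearCombination c vs
linearCombination-0∷ c v vs =
  trans (cong (_+ᵛ linearCombination c vs) (0*ᵛ v)) (+ᵛ-identityˡ _)

linearCombination-0 : (vs : Vec (𝔽₂^ n) k) → linearCombination 0ᵛ vs ≡ 0ᵛ
linearCombination-0 []       = refl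
linearCombination-0 (v ∷ vs) = trans (linearCombination-0∷ 0ᵛ v vs) (linearCombination-0 vs)

head∈Span : (v : 𝔽₂^ n) (vs : Vec (𝔽₂^ n) k) → v ∈ Span (v ∷ vs)
head∈Span v vs = (1ℙ ∷ 0ᵛ) ,
  trans (cong₂ _+ᵛ_ (1*ᵛ v) (linearCombination-0 vs)) (+ᵛ-identityʳ v)

Span-∷ : (v : 𝔽₂^ n) {vs : Vec (𝔽₂^ n) k} → Span vs ⊆ Span (v ∷ vs)
Span-∷ v (c , eq) = (0ℙ ∷ c) , trans (linearCombination-0∷ c v _) eq

independent-∷ : {v : 𝔽₂^ n} {vs : Vec (𝔽₂^ n) k} → v ∉ Span vs →
  LinearlyIndependent vs → LinearlyIndependent (v ∷ vs)
independent-∷ {v = v} {vs} v∉ ind (0ℙ ∷ c) eq =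
  cong (0ℙ ∷_) (ind c (trans (sym (linearCombination-0∷ c v vs)) eq))
independent-∷ {v = v} {vs} v∉ ind (1ℙ ∷ c) eq = contradiction
  (c , trans (+ᵛ≡0⇒≡ (1ℙ *ᵛ v) (linearCombination c vs) eq) (1*ᵛ v)) v∉

-- Run through xs, keeping each vector of S that is not in the span of the
-- vectors already kept.
basisOf : {S : Pred (𝔽₂^ n) 0ℓ} → Decidable S → (xs : List (𝔽₂^ n)) →
  ∃ λ k → ∃ λ (vs : Vec (𝔽₂^ n) k) →
    All S vs × LinearlyIndependent vs × (∀ {v} → v ∈ˡ xs → v ∈ S → v ∈ Span vs)
basisOf S? [] = 0 , [] , [] , (λ { [] _ → refl }) , λ ()
basisOf S? (x ∷ xs) with basisOf S? xs
... | k , vs , mem , ind , span with S? x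
...   | no x∉S = k , vs , mem , ind , λ
        { (here refl) x∈S → contradiction x∈S x∉S
        ; (there v∈xs)    → span v∈xs }
...   | yes x∈S with Span? vs x
...     | yes x∈Span = k , vs , mem , ind , λ
          { (here refl) _ → x∈Span
          ; (there v∈xs)  → span v∈xs }
...     | no x∉Span = suc k , x ∷ vs , x∈S ∷ mem , independent-∷ x∉Span ind , λ
          { (here refl) _    → head∈Span x vs
          ; (there v∈xs) v∈S → Span-∷ x (span v∈xs v∈S) }

basis : {S : Pred (𝔽₂^ n) 0ℓ} → Decidable S →
  ∃ λ k → ∃ λ (vs : Vec (𝔽₂^ n) k) → IsBasis S vs
basis {n = n} S? with basisOf S? (allVectors n)
... | k , vs , mem , ind , span = k , vs , record
  { members     = mem
  ; independent = ind
  ; spanning    = λ {v} → span (∈-allVectors v)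
  }

-- When S is a subspace, the choice of basis does not matter.
dim : {S : Pred (𝔽₂^ n) 0ℓ} → Decidable S → ℕ
dim S? = proj₁ (basis S?)

null : Matrix m n → ℕ
null M = dim (Ker? M)

rank : Matrix m n → ℕ
rank M = dim (Im? M)

{-# OPTIONS --safe #-}

-- The matrix N = M + uuᵀ acts by Nx = Mx + (uᵀx)u.  If u = My, this reads
-- Nx = M(x + (uᵀx)y).  For uᵀy = 0 the map x ↦ x + (uᵀx)y is an involution,
-- so Im N = Im M.  For uᵀy = 1 symmetry gives uᵀx = 0 on Ker M, and
-- Ker M = {x ∈ Ker N : uᵀx = 0}, a hyperplane since y ∈ Ker N.  If u ∉ Im M,
-- then Ker N = {x ∈ Ker M : uᵀx = 0}, which is a hyperplane because u is not
-- orthogonal to Ker M (the Fredholm alternative).  Rank–nullity gives the rest.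
module Submission where

open import Defs
open import Data.Fin.Base using (Fin; zero; suc; combine)
open import Data.Fin.Properties using (combine-injective; combine-surjective; injective⇒≤)
open import Data.Nat.Base using (ℕ; zero; suc; _+_; _^_; _≤_)
import Data.Nat.Properties as ℕ
open import Data.Parity.Base as ℙ using (0ℙ; 1ℙ)
import Data.Parity.Properties as ℙ
open import Algebra.Properties.CommutativeSemigroup ℙ.+-commutativeSemigroup using (interchange)
open import Data.Product.Base using (∃; _×_; _,_; proj₁; proj₂)
open import Data.Sum.Base using (_⊎_; inj₁; inj₂)
open import Data.Vec.Base using (Vec; []; _∷_; _++_; _⊛_; map; replicate; splitAt; transpose)
open import Data.Vec.Properties using (zipWith-assoc; zipWith-comm)
open import Data.Vec.Relation.Unary.All as All using (All; []; _∷_)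
open import Function.Base using (_∘_)
open import Function.Definitions using (Injective)
open import Level using (0ℓ)
open import Relation.Binary.PropositionalEquality
  using (_≡_; _≢_; refl; sym; trans; cong; cong₂; module ≡-Reasoning)
open import Relation.Nullary.Negation using (contradiction)
open import Relation.Unary using (Pred; Decidable; _∈_; _∉_; _⊆_)

open ≡-Reasoning

private
  variable
    k l m n : ℕ
    S T : Pred (𝔽₂^ n) 0ℓ

-- Linear algebra over 𝔽₂

+ᵛ-self : (v : 𝔽₂^ n) → v +ᵛ v ≡ 0ᵛ
+ᵛ-self []      = refl
+ᵛ-self (a ∷ v) = cong₂ _∷_ (ℙ.p+p≡0ℙ a) (+ᵛ-self v)

+ᵛ-assoc : (u v w : 𝔽₂^ n) → (u +ᵛ v) +ᵛ w ≡ u +ᵛ (v +ᵛ w)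
+ᵛ-assoc = zipWith-assoc ℙ.+-assoc

+ᵛ-comm : (u v : 𝔽₂^ n) → u +ᵛ v ≡ v +ᵛ u
+ᵛ-comm = zipWith-comm ℙ.+-comm

+ᵛ-interchange : (u v w x : 𝔽₂^ n) → (u +ᵛ v) +ᵛ (w +ᵛ x) ≡ (u +ᵛ w) +ᵛ (v +ᵛ x)
+ᵛ-interchange []      []      []      []      = refl
+ᵛ-interchange (a ∷ u) (b ∷ v) (c ∷ w) (d ∷ x) =
  cong₂ _∷_ (interchange a b c d) (+ᵛ-interchange u v w x)

+ᵛ-involutiveʳ : (v w : 𝔽₂^ n) → (v +ᵛ w) +ᵛ w ≡ v
+ᵛ-involutiveʳ v w = begin
  (v +ᵛ w) +ᵛ w  ≡⟨ +ᵛ-assoc v w w ⟩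
  v +ᵛ (w +ᵛ w)  ≡⟨ cong (v +ᵛ_) (+ᵛ-self w) ⟩
  v +ᵛ 0ᵛ        ≡⟨ +ᵛ-identityʳ v ⟩
  v              ∎

+ᵛ-involutiveˡ : (v w : 𝔽₂^ n) → v +ᵛ (w +ᵛ v) ≡ w
+ᵛ-involutiveˡ v w = trans (+ᵛ-comm v (w +ᵛ v)) (+ᵛ-involutiveʳ w v)

*ᵛ-zeroʳ : ∀ a → a *ᵛ 0ᵛ {n} ≡ 0ᵛ
*ᵛ-zeroʳ 0ℙ = 0*ᵛ 0ᵛ
*ᵛ-zeroʳ 1ℙ = 1*ᵛ 0ᵛ

*ᵛ-distribʳ-+ : (v : 𝔽₂^ n) → ∀ a b → (a ℙ.+ b) *ᵛ v ≡ a *ᵛ v +ᵛ b *ᵛ v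
*ᵛ-distribʳ-+ []      a b = refl
*ᵛ-distribʳ-+ (c ∷ v) a b = cong₂ _∷_ (ℙ.*-distribʳ-+ c a b) (*ᵛ-distribʳ-+ v a b)

·-comm : (u v : 𝔽₂^ n) → u · v ≡ v · u
·-comm []      []      = refl
·-comm (a ∷ u) (b ∷ v) = cong₂ ℙ._+_ (ℙ.*-comm a b) (·-comm u v)

·-zeroˡ : (v : 𝔽₂^ n) → 0ᵛ · v ≡ 0ℙ
·-zeroˡ []      = refl
·-zeroˡ (a ∷ v) = ·-zeroˡ v

·-zeroʳ : (v : 𝔽₂^ n) → v · 0ᵛ ≡ 0ℙ
·-zeroʳ v = trans (·-comm v 0ᵛ) (·-zeroˡ v)

·-distribˡ-+ᵛ : (u v w : 𝔽₂^ n) → u · (v +ᵛ w) ≡ (u · v) ℙ.+ (u · w)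
·-distribˡ-+ᵛ []      []      []      = refl
·-distribˡ-+ᵛ (a ∷ u) (b ∷ v) (c ∷ w) = trans
  (cong₂ ℙ._+_ (ℙ.*-distribˡ-+ a b c) (·-distribˡ-+ᵛ u v w))
  (interchange (a ℙ.* b) (a ℙ.* c) (u · v) (u · w))

·-distribʳ-+ᵛ : (w u v : 𝔽₂^ n) → (u +ᵛ v) · w ≡ (u · w) ℙ.+ (v · w)
·-distribʳ-+ᵛ w u v = begin
  (u +ᵛ v) · w          ≡⟨ ·-comm (u +ᵛ v) w ⟩
  w · (u +ᵛ v)          ≡⟨ ·-distribˡ-+ᵛ w u v ⟩
  (w · u) ℙ.+ (w · v)   ≡⟨ cong₂ ℙ._+_ (·-comm w u) (·-comm w v) ⟩
  (u · w) ℙ.+ (v · w)   ∎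

*ᵛ-·-assoc : ∀ a (u v : 𝔽₂^ n) → (a *ᵛ u) · v ≡ a ℙ.* (u · v)
*ᵛ-·-assoc 0ℙ u v = trans (cong (_· v) (0*ᵛ u)) (·-zeroˡ v)
*ᵛ-·-assoc 1ℙ u v = cong (_· v) (1*ᵛ u)

·-*ᵛ-assoc : ∀ a (u v : 𝔽₂^ n) → u · (a *ᵛ v) ≡ a ℙ.* (u · v)
·-*ᵛ-assoc a u v = begin
  u · (a *ᵛ v)   ≡⟨ ·-comm u (a *ᵛ v) ⟩
  (a *ᵛ v) · u   ≡⟨ *ᵛ-·-assoc a v u ⟩
  a ℙ.* (v · u)  ≡⟨ cong (a ℙ.*_) (·-comm v u) ⟩
  a ℙ.* (u · v)  ∎

*ᴹ-zeroʳ : (A : Matrix m n) → A *ᴹ 0ᵛ ≡ 0ᵛ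
*ᴹ-zeroʳ []      = refl
*ᴹ-zeroʳ (r ∷ A) = cong₂ _∷_ (·-zeroʳ r) (*ᴹ-zeroʳ A)

*ᴹ-distribˡ-+ᵛ : (A : Matrix m n) (v w : 𝔽₂^ n) → A *ᴹ (v +ᵛ w) ≡ A *ᴹ v +ᵛ A *ᴹ w
*ᴹ-distribˡ-+ᵛ []      v w = refl
*ᴹ-distribˡ-+ᵛ (r ∷ A) v w = cong₂ _∷_ (·-distribˡ-+ᵛ r v w) (*ᴹ-distribˡ-+ᵛ A v w)

*ᴹ-*ᵛ : (A : Matrix m n) → ∀ a (v : 𝔽₂^ n) → A *ᴹ (a *ᵛ v) ≡ a *ᵛ (A *ᴹ v)
*ᴹ-*ᵛ []      a v = refl
*ᴹ-*ᵛ (r ∷ A) a v = cong₂ _∷_ (·-*ᵛ-assoc a r v) (*ᴹ-*ᵛ A a v)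

Ker-+ᵛ : (A : Matrix m n) {v w : 𝔽₂^ n} → v ∈ Ker A → w ∈ Ker A → v +ᵛ w ∈ Ker A
Ker-+ᵛ A {v} {w} v∈ w∈ =
  trans (*ᴹ-distribˡ-+ᵛ A v w) (trans (cong₂ _+ᵛ_ v∈ w∈) (+ᵛ-self 0ᵛ))

linearCombination-+ᵛ : (c d : 𝔽₂^ k) (vs : Vec (𝔽₂^ n) k) →
  linearCombination (c +ᵛ d) vs ≡ linearCombination c vs +ᵛ linearCombination d vs
linearCombination-+ᵛ []      []      []       = sym (+ᵛ-self 0ᵛ)
linearCombination-+ᵛ (a ∷ c) (b ∷ d) (v ∷ vs) = trans
  (cong₂ _+ᵛ_ (*ᵛ-distribʳ-+ v a b) (linearCombination-+ᵛ c d vs))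
  (+ᵛ-interchange (a *ᵛ v) (b *ᵛ v) _ _)

linearCombination-++ : (c : 𝔽₂^ k) (d : 𝔽₂^ l) (vs : Vec (𝔽₂^ n) k) (ws : Vec (𝔽₂^ n) l) →
  linearCombination (c ++ d) (vs ++ ws) ≡ linearCombination c vs +ᵛ linearCombination d ws
linearCombination-++ []      d []       ws = sym (+ᵛ-identityˡ _)
linearCombination-++ (a ∷ c) d (v ∷ vs) ws = trans
  (cong (a *ᵛ v +ᵛ_) (linearCombination-++ c d vs ws))
  (sym (+ᵛ-assoc (a *ᵛ v) _ _))

*ᴹ-linearCombination : (A : Matrix m n) (c : 𝔽₂^ k) (vs : Vec (𝔽₂^ n) k) →
  A *ᴹ linearCombination c vs ≡ linearCombination c (map (A *ᴹ_) vs)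
*ᴹ-linearCombination A []      []       = *ᴹ-zeroʳ A
*ᴹ-linearCombination A (a ∷ c) (v ∷ vs) = trans
  (*ᴹ-distribˡ-+ᵛ A (a *ᵛ v) _)
  (cong₂ _+ᵛ_ (*ᴹ-*ᵛ A a v) (*ᴹ-linearCombination A c vs))

-- Adjointness: the rows of `A` serve as the family, so `linearCombination c A` plays the role of
-- the transpose of `A` applied to `c`.
linearCombination-· : (A : Matrix m n) (c : 𝔽₂^ m) (v : 𝔽₂^ n) →
  linearCombination c A · v ≡ c · (A *ᴹ v)
linearCombination-· []      []      v = ·-zeroˡ v
linearCombination-· (r ∷ A) (a ∷ c) v = trans
  (·-distribʳ-+ᵛ v (a *ᵛ r) _)
  (cong₂ ℙ._+_ (*ᵛ-·-assoc a r v) (linearCombination-· A c v))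

-- Transposes, symmetric matrices and rank-one terms

-- The matrix on the left is `A` with `r` prepended as first column, the form to which `transpose`
-- of a cons unfolds.
*ᴹ-∷ : (r : 𝔽₂^ n) (A : Matrix n k) (a : 𝔽₂) (c : 𝔽₂^ k) →
  (replicate n _∷_ ⊛ r ⊛ A) *ᴹ (a ∷ c) ≡ a *ᵛ r +ᵛ A *ᴹ c
*ᴹ-∷ []      []      a c = refl
*ᴹ-∷ (b ∷ r) (s ∷ A) a c = cong₂ _∷_ (cong (ℙ._+ (s · c)) (ℙ.*-comm b a)) (*ᴹ-∷ r A a c)

transpose-[]-*ᴹ : ∀ n → transpose {n = n} [] *ᴹ [] ≡ 0ᵛ
transpose-[]-*ᴹ zero    = refl
transpose-[]-*ᴹ (suc n) = cong (0ℙ ∷_) (transpose-[]-*ᴹ n)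

transpose-*ᴹ : (A : Matrix m n) (c : 𝔽₂^ m) → transpose A *ᴹ c ≡ linearCombination c A
transpose-*ᴹ {n = n} [] [] = transpose-[]-*ᴹ n
transpose-*ᴹ (r ∷ A) (a ∷ c) =
  trans (*ᴹ-∷ r (transpose A) a c) (cong (a *ᵛ r +ᵛ_) (transpose-*ᴹ A c))

module _ (M : Matrix n n) (M-sym : Symmetric M) where

  -- Every use of symmetry passes through this identification of column combinations with row
  -- combinations.
  symmetric-*ᴹ : ∀ c → M *ᴹ c ≡ linearCombination c M
  symmetric-*ᴹ c = trans (cong (_*ᴹ c) (sym M-sym)) (transpose-*ᴹ M c)

  selfAdjoint : ∀ x y → (M *ᴹ x) · y ≡ x · (M *ᴹ y)
  selfAdjoint x y = trans (cong (_· y) (symmetric-*ᴹ x)) (linearCombination-· M x y)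

⊗-*ᴹ : (A : Matrix m n) (u : 𝔽₂^ m) (v x : 𝔽₂^ n) →
  (A +ᴹ u ⊗ v) *ᴹ x ≡ A *ᴹ x +ᵛ (v · x) *ᵛ u
⊗-*ᴹ []      []      v x = refl
⊗-*ᴹ (r ∷ A) (a ∷ u) v x = cong₂ _∷_
  (begin
    (r +ᵛ a *ᵛ v) · x              ≡⟨ ·-distribʳ-+ᵛ x r (a *ᵛ v) ⟩
    (r · x) ℙ.+ ((a *ᵛ v) · x)     ≡⟨ cong ((r · x) ℙ.+_) (*ᵛ-·-assoc a v x) ⟩
    (r · x) ℙ.+ (a ℙ.* (v · x))    ≡⟨ cong ((r · x) ℙ.+_) (ℙ.*-comm a (v · x)) ⟩
    (r · x) ℙ.+ ((v · x) ℙ.* a)    ∎)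
  (⊗-*ᴹ A u v x)

-- The Fredholm alternative

-- The witness is the standard basis vector at the first nonzero coordinate of `u`.
nondegenerate : (u : 𝔽₂^ n) → u ≡ 0ᵛ ⊎ ∃ λ z → u · z ≡ 1ℙ
nondegenerate []       = inj₁ refl
nondegenerate (1ℙ ∷ u) = inj₂ (1ℙ ∷ 0ᵛ , cong (1ℙ ℙ.+_) (·-zeroʳ u))
nondegenerate (0ℙ ∷ u) with nondegenerate u
... | inj₁ u≡0       = inj₁ (cong (0ℙ ∷_) u≡0)
... | inj₂ (z , u·z) = inj₂ (0ℙ ∷ z , u·z)

-- Induction on the rows. A witness `z` for the remaining rows may fail only at the new row `r`;
-- then the alternative for `u +ᵛ r` either puts `u` in the span or yields a second vector with
-- which to correct `z`.
fredholm : (A : Matrix m n) (u : 𝔽₂^ n) → u ∈ Span A ⊎ ∃ λ z → z ∈ Ker A × u · z ≡ 1ℙ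
fredholm [] u with nondegenerate u
... | inj₁ u≡0       = inj₁ ([] , sym u≡0)
... | inj₂ (z , u·z) = inj₂ (z , refl , u·z)
fredholm (r ∷ A) u with fredholm A u
... | inj₁ u∈Span = inj₁ (Span-∷ r u∈Span)
... | inj₂ (z , z∈Ker , u·z) with r · z in r·z
...   | 0ℙ = inj₂ (z , cong₂ _∷_ r·z z∈Ker , u·z)
...   | 1ℙ with fredholm A (u +ᵛ r)
...     | inj₁ (c , eq) = inj₁ (1ℙ ∷ c ,
          trans (cong₂ _+ᵛ_ (1*ᵛ r) eq) (+ᵛ-involutiveˡ r u))
...     | inj₂ (z′ , z′∈Ker , u+r·z′)
            -- The two pairings with `z′` sum to `1ℙ`, so exactly one of them is `1ℙ`.
            with r · z′ in r·z′ | u · z′ in u·z′ | trans (sym (·-distribʳ-+ᵛ z′ u r)) u+r·z′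
...       | 0ℙ | 1ℙ | _ = inj₂ (z′ , cong₂ _∷_ r·z′ z′∈Ker , u·z′)
-- Both `z` and `z′` pair to `1ℙ` with `r`, which cancels in the sum, while only `z` pairs to `1ℙ`
-- with `u`.
...       | 1ℙ | 0ℙ | _ = inj₂ (z +ᵛ z′
            , cong₂ _∷_ (trans (·-distribˡ-+ᵛ r z z′) (cong₂ ℙ._+_ r·z r·z′)) (Ker-+ᵛ A z∈Ker z′∈Ker)
            , trans (·-distribˡ-+ᵛ u z z′) (cong₂ ℙ._+_ u·z u·z′))
...       | 0ℙ | 0ℙ | ()
...       | 1ℙ | 1ℙ | ()

-- Dimension

toFin : 𝔽₂ → Fin 2
toFin 0ℙ = zero
toFin 1ℙ = suc zero

toFin-injective : Injective _≡_ _≡_ toFin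
toFin-injective {0ℙ} {0ℙ} _ = refl
toFin-injective {1ℙ} {1ℙ} _ = refl

-- Binary expansion with the head as leading digit, used to compare dimensions by counting.
encode : ∀ k → 𝔽₂^ k → Fin (2 ^ k)
encode zero    []      = zero
encode (suc k) (a ∷ v) = combine (toFin a) (encode k v)

encode-injective : ∀ k → Injective _≡_ _≡_ (encode k)
encode-injective zero    {[]}    {[]}    _  = refl
encode-injective (suc k) {a ∷ v} {b ∷ w} eq =
  let eqᵃ , eqᵛ = combine-injective (toFin a) (encode k v) (toFin b) (encode k w) eq
  in cong₂ _∷_ (toFin-injective eqᵃ) (encode-injective k eqᵛ)

encode-surjective : ∀ k (i : Fin (2 ^ k)) → ∃ λ v → encode k v ≡ i
encode-surjective zero    zero = [] , refl
encode-surjective (suc k) i with combine-surjective {2} {2 ^ k} i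
... | zero , j , eq =
  let v , eqᵛ = encode-surjective k j in 0ℙ ∷ v , trans (cong (combine {2} zero) eqᵛ) eq
... | suc zero , j , eq =
  let v , eqᵛ = encode-surjective k j in 1ℙ ∷ v , trans (cong (combine {2} (suc zero)) eqᵛ) eq

-- Any injection will do, linear or not, because 𝔽₂^ k has 2 ^ k elements.
injection⇒≤ : {f : 𝔽₂^ k → 𝔽₂^ l} → Injective _≡_ _≡_ f → k ≤ l
injection⇒≤ {k} {l} {f} f-inj = ℕ.≮⇒≥ λ l<k →
  contradiction (injective⇒≤ g-inj) (ℕ.<⇒≱ (ℕ.^-monoʳ-< 2 ℕ.≤-refl l<k))
  where
  decode : Fin (2 ^ k) → 𝔽₂^ k
  decode i = proj₁ (encode-surjective k i)

  g-inj : Injective _≡_ _≡_ (encode l ∘ f ∘ decode)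
  g-inj {i} {j} eq = begin
    i                    ≡⟨ proj₂ (encode-surjective k i) ⟨
    encode k (decode i)  ≡⟨ cong (encode k) (f-inj (encode-injective l eq)) ⟩
    encode k (decode j)  ≡⟨ proj₂ (encode-surjective k j) ⟩
    j                    ∎

-- Sizes of independent and spanning families

independent⇒injective : {vs : Vec (𝔽₂^ n) k} → LinearlyIndependent vs →
  Injective _≡_ _≡_ (λ c → linearCombination c vs)
independent⇒injective {vs = vs} ind {c} {d} eq = sym (+ᵛ≡0⇒≡ c d (ind (c +ᵛ d) (begin
  linearCombination (c +ᵛ d) vs                       ≡⟨ linearCombination-+ᵛ c d vs ⟩
  linearCombination c vs +ᵛ linearCombination d vs    ≡⟨ cong (_+ᵛ _) eq ⟩
  linearCombination d vs +ᵛ linearCombination d vs    ≡⟨ +ᵛ-self _ ⟩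
  0ᵛ                                                  ∎)))

-- A choice of coefficients for each vector is injective, since the vector can be rebuilt from them.
spanning⇒≥ : {vs : Vec (𝔽₂^ n) k} → (∀ v → v ∈ Span vs) → n ≤ k
spanning⇒≥ {vs = vs} span = injection⇒≤ {f = proj₁ ∘ span} λ {v} {w} eq → begin
  v                                         ≡⟨ proj₂ (span v) ⟨
  linearCombination (proj₁ (span v)) vs     ≡⟨ cong (λ c → linearCombination c vs) eq ⟩
  linearCombination (proj₁ (span w)) vs     ≡⟨ proj₂ (span w) ⟩
  w                                         ∎

Span-*ᵛ : {vs : Vec (𝔽₂^ n) k} {v : 𝔽₂^ n} → ∀ a → v ∈ Span vs → a *ᵛ v ∈ Span vs
Span-*ᵛ {vs = vs} {v} 0ℙ _ = 0ᵛ , trans (linearCombination-0 vs) (sym (0*ᵛ v))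
Span-*ᵛ {v = v} 1ℙ (c , eq) = c , trans eq (sym (1*ᵛ v))

Span-+ᵛ : {vs : Vec (𝔽₂^ n) k} {v w : 𝔽₂^ n} →
  v ∈ Span vs → w ∈ Span vs → v +ᵛ w ∈ Span vs
Span-+ᵛ {vs = vs} (c , eqᶜ) (d , eqᵈ) =
  c +ᵛ d , trans (linearCombination-+ᵛ c d vs) (cong₂ _+ᵛ_ eqᶜ eqᵈ)

Span-linearCombination : {vs : Vec (𝔽₂^ n) k} {ws : Vec (𝔽₂^ n) l} →
  All (Span ws) vs → ∀ c → linearCombination c vs ∈ Span ws
Span-linearCombination {ws = ws} []       []      = 0ᵛ , linearCombination-0 ws
Span-linearCombination {ws = ws} (p ∷ ps) (a ∷ c) =
  Span-+ᵛ {vs = ws} (Span-*ᵛ {vs = ws} a p) (Span-linearCombination ps c)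

-- The Steinitz bound by counting instead of exchange: rewriting combinations of `vs` over `ws` is
-- injective on coefficients, because the new coefficients determine the vector and the vector
-- determines the old ones.
independent-≤ : {vs : Vec (𝔽₂^ n) k} {ws : Vec (𝔽₂^ n) l} →
  LinearlyIndependent vs → All (Span ws) vs → k ≤ l
independent-≤ {vs = vs} {ws} ind vs⊆ = injection⇒≤ {f = proj₁ ∘ coeffs} λ {c} {d} eq →
  independent⇒injective ind (begin
    linearCombination c vs                  ≡⟨ proj₂ (coeffs c) ⟨
    linearCombination (proj₁ (coeffs c)) ws ≡⟨ cong (λ e → linearCombination e ws) eq ⟩
    linearCombination (proj₁ (coeffs d)) ws ≡⟨ proj₂ (coeffs d) ⟩
    linearCombination d vs                  ∎)
  where
  coeffs : ∀ c → linearCombination c vs ∈ Span ws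
  coeffs = Span-linearCombination vs⊆

IsBasis-≤ : {vs : Vec (𝔽₂^ n) k} {ws : Vec (𝔽₂^ n) l} →
  S ⊆ T → IsBasis S vs → IsBasis T ws → k ≤ l
IsBasis-≤ S⊆T bvs bws =
  independent-≤ (IsBasis.independent bvs) (All.map (IsBasis.spanning bws ∘ S⊆T) (IsBasis.members bvs))

dim-≤ : (S? : Decidable S) (T? : Decidable T) → S ⊆ T → dim S? ≤ dim T?
dim-≤ S? T? S⊆T = IsBasis-≤ S⊆T (proj₂ (proj₂ (basis S?))) (proj₂ (proj₂ (basis T?)))

-- `dim` counts a basis found by a search that consults the decision procedure, so independence of
-- that procedure has to be proved.
dim-cong : (S? : Decidable S) (T? : Decidable T) → S ⊆ T → T ⊆ S → dim S? ≡ dim T?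
dim-cong S? T? S⊆T T⊆S = ℕ.≤-antisym (dim-≤ S? T? S⊆T) (dim-≤ T? S? T⊆S)

-- Hyperplane sections

module _ {S T : Pred (𝔽₂^ n) 0ℓ} (S? : Decidable S) (T? : Decidable T)
  (u : 𝔽₂^ n) (S⊆T : S ⊆ T) (S⊆u⊥ : ∀ {x} → x ∈ S → u · x ≡ 0ℙ)
  (T∩u⊥⊆S : ∀ {x} → x ∈ T → u · x ≡ 0ℙ → x ∈ S)
  (T-+ᵛ : ∀ {x y} → x ∈ T → y ∈ T → x +ᵛ y ∈ T)
  {z : 𝔽₂^ n} (z∈T : z ∈ T) (u·z : u · z ≡ 1ℙ) where

  -- `S` is the part of `T` orthogonal to `u`. A vector of `T` outside `S` falls into `S` once `z`
  -- is added, so `z` alone completes a basis.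
  hyperplane-basis : {vs : Vec (𝔽₂^ n) k} → IsBasis S vs → IsBasis T (z ∷ vs)
  hyperplane-basis {vs = vs} b = record
    { members     = z∈T ∷ All.map S⊆T members
    ; independent = independent-∷ z∉Span independent
    ; spanning    = spanning′
    }
    where
    open IsBasis b

    -- Reading a family as the rows of a matrix turns orthogonality to `u` into membership of `u` in
    -- a kernel; hence `u` is orthogonal to all of `Span vs`, but not to `z`.
    Ker-vs : {ws : Vec (𝔽₂^ n) l} → All S ws → u ∈ Ker ws
    Ker-vs []       = refl
    Ker-vs (w∈ ∷ p) = cong₂ _∷_ (trans (·-comm _ u) (S⊆u⊥ w∈)) (Ker-vs p)

    z∉Span : z ∉ Span vs
    z∉Span (c , eq) with () ← begin
      1ℙ                           ≡⟨ u·z ⟨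
      u · z                        ≡⟨ ·-comm u z ⟩
      z · u                        ≡⟨ cong (_· u) eq ⟨
      linearCombination c vs · u   ≡⟨ linearCombination-· vs c u ⟩
      c · (vs *ᴹ u)                ≡⟨ cong (c ·_) (Ker-vs members) ⟩
      c · 0ᵛ                       ≡⟨ ·-zeroʳ c ⟩
      0ℙ                           ∎

    spanning′ : T ⊆ Span (z ∷ vs)
    spanning′ {x} x∈T with u · x in u·x
    ... | 0ℙ = Span-∷ z (spanning (T∩u⊥⊆S x∈T u·x))
    ... | 1ℙ =
      let c , eq = spanning (T∩u⊥⊆S (T-+ᵛ x∈T z∈T)
                     (trans (·-distribˡ-+ᵛ u x z) (cong₂ ℙ._+_ u·x u·z)))
      in 1ℙ ∷ c , trans (cong₂ _+ᵛ_ (1*ᵛ z) eq) (+ᵛ-involutiveˡ z x)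

  dim-hyperplane : dim S? + 1 ≡ dim T?
  dim-hyperplane = trans (ℕ.+-comm (dim S?) 1)
    (ℕ.≤-antisym (IsBasis-≤ (λ x∈ → x∈) bᶻ bᵀ) (IsBasis-≤ (λ x∈ → x∈) bᵀ bᶻ))
    where
    bᶻ = hyperplane-basis (proj₂ (proj₂ (basis S?)))
    bᵀ = proj₂ (proj₂ (basis T?))

-- Rank-nullity

preimages : (A : Matrix m n) {ws : Vec (𝔽₂^ m) k} → All (Im A) ws →
  ∃ λ ps → map (A *ᴹ_) ps ≡ ws
preimages A []             = [] , refl
preimages A ((p , eq) ∷ q) = let ps , eqs = preimages A q in p ∷ ps , cong₂ _∷_ eq eqs

0ᵛ-++ : ∀ k l → 0ᵛ {k} ++ 0ᵛ {l} ≡ 0ᵛ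
0ᵛ-++ zero    l = refl
0ᵛ-++ (suc k) l = cong (0ℙ ∷_) (0ᵛ-++ k l)

-- Preimages `ps` of the basis of the image, followed by the basis of the kernel, are independent
-- and span the whole domain; the two counting bounds then give equality.
Im-Ker-bases : (A : Matrix m n) {ws : Vec (𝔽₂^ m) l} {vs : Vec (𝔽₂^ n) k} →
  IsBasis (Im A) ws → IsBasis (Ker A) vs → l + k ≡ n
Im-Ker-bases {n = n} {l = r} {k = k} A {vs = vs} bᴵ bᴷ with preimages A (IsBasis.members bᴵ)
... | ps , refl =
  ℕ.≤-antisym (injection⇒≤ (independent⇒injective ind)) (spanning⇒≥ {vs = ps ++ vs} span)
  where
  module I = IsBasis bᴵ
  module K = IsBasis bᴷ

  A-vs : {us : Vec (𝔽₂^ n) l} → All (Ker A) us → ∀ d → A *ᴹ linearCombination d us ≡ 0ᵛ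
  A-vs []      []      = *ᴹ-zeroʳ A
  A-vs (p ∷ q) (a ∷ d) = Ker-+ᵛ A (trans (*ᴹ-*ᵛ A a _) (trans (cong (a *ᵛ_) p) (*ᵛ-zeroʳ a))) (A-vs q d)

  ind : LinearlyIndependent (ps ++ vs)
  ind e eq with splitAt r e
  ... | c , d , refl = trans (cong₂ _++_ c≡0 d≡0) (0ᵛ-++ r k)
    where
    sum≡0 : linearCombination c ps +ᵛ linearCombination d vs ≡ 0ᵛ
    sum≡0 = trans (sym (linearCombination-++ c d ps vs)) eq

    -- The two partial sums agree, and `A` kills the one over the kernel basis, so the images of
    -- `ps` satisfy a relation with coefficients `c`.
    c≡0 : c ≡ 0ᵛ
    c≡0 = I.independent c (begin
      linearCombination c (map (A *ᴹ_) ps)  ≡⟨ *ᴹ-linearCombination A c ps ⟨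
      A *ᴹ linearCombination c ps           ≡⟨ cong (A *ᴹ_) (+ᵛ≡0⇒≡ _ _ sum≡0) ⟨
      A *ᴹ linearCombination d vs           ≡⟨ A-vs K.members d ⟩
      0ᵛ                                    ∎)

    d≡0 : d ≡ 0ᵛ
    d≡0 = K.independent d (begin
      linearCombination d vs   ≡⟨ +ᵛ≡0⇒≡ _ _ sum≡0 ⟩
      linearCombination c ps   ≡⟨ cong (λ e → linearCombination e ps) c≡0 ⟩
      linearCombination 0ᵛ ps  ≡⟨ linearCombination-0 ps ⟩
      0ᵛ                       ∎)

  span : ∀ x → x ∈ Span (ps ++ vs)
  span x =
    -- Expanding `A *ᴹ x` in the basis of the image gives a combination `p` of `ps` with the same
    -- image as `x`, so `x +ᵛ p` lies in the kernel.
    let c , eqᶜ = I.spanning (x , refl)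
        p       = linearCombination c ps
        d , eqᵈ = K.spanning {x +ᵛ p} (begin
          A *ᴹ (x +ᵛ p)        ≡⟨ *ᴹ-distribˡ-+ᵛ A x p ⟩
          A *ᴹ x +ᵛ A *ᴹ p     ≡⟨ cong (A *ᴹ x +ᵛ_) (trans (*ᴹ-linearCombination A c ps) eqᶜ) ⟩
          A *ᴹ x +ᵛ A *ᴹ x     ≡⟨ +ᵛ-self _ ⟩
          0ᵛ                   ∎)
    in c ++ d , (begin
      linearCombination (c ++ d) (ps ++ vs)  ≡⟨ linearCombination-++ c d ps vs ⟩
      p +ᵛ linearCombination d vs            ≡⟨ cong (p +ᵛ_) eqᵈ ⟩
      p +ᵛ (x +ᵛ p)                          ≡⟨ +ᵛ-involutiveˡ p x ⟩
      x                                      ∎)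

rank-nullity : (A : Matrix m n) → rank A + null A ≡ n
rank-nullity A =
  Im-Ker-bases A (proj₂ (proj₂ (basis (Im? A)))) (proj₂ (proj₂ (basis (Ker? A))))

rank≡⇒null≡ : (A B : Matrix m n) → rank A ≡ rank B → null A ≡ null B
rank≡⇒null≡ A B eq = ℕ.+-cancelˡ-≡ (rank B) _ _
  (trans (cong (_+ null A) (sym eq)) (trans (rank-nullity A) (sym (rank-nullity B))))

-- Serves both jumps: `A` is the updated matrix when `u ∉ Im M`, and the original one when
-- `u · y ≡ 1ℙ`.
null+1⇒rank+1 : (A B : Matrix m n) → null A + 1 ≡ null B → rank A ≡ rank B + 1
null+1⇒rank+1 A B eq = ℕ.+-cancelʳ-≡ (null A) _ _ (begin
  rank A + null A          ≡⟨ rank-nullity A ⟩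
  _                        ≡⟨ rank-nullity B ⟨
  rank B + null B          ≡⟨ cong (rank B +_) eq ⟨
  rank B + (null A + 1)    ≡⟨ cong (rank B +_) (ℕ.+-comm (null A) 1) ⟩
  rank B + (1 + null A)    ≡⟨ ℕ.+-assoc (rank B) 1 (null A) ⟨
  rank B + 1 + null A      ∎)

-- The rank-one update

module _ {n : ℕ} (M : Matrix n n) (M-sym : Symmetric M) (u : 𝔽₂^ n) where

  N : Matrix n n
  N = M +ᴹ u ⊗ u

  u·x≡0⇒N≡M : ∀ {x} → u · x ≡ 0ℙ → N *ᴹ x ≡ M *ᴹ x
  u·x≡0⇒N≡M {x} u·x = begin
    N *ᴹ x                     ≡⟨ ⊗-*ᴹ M u u x ⟩
    M *ᴹ x +ᵛ (u · x) *ᵛ u     ≡⟨ cong (λ a → M *ᴹ x +ᵛ a *ᵛ u) u·x ⟩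
    M *ᴹ x +ᵛ 0ℙ *ᵛ u          ≡⟨ cong (M *ᴹ x +ᵛ_) (0*ᵛ u) ⟩
    M *ᴹ x +ᵛ 0ᵛ               ≡⟨ +ᵛ-identityʳ _ ⟩
    M *ᴹ x                     ∎

  u·x≡1⇒N≡M+u : ∀ {x} → u · x ≡ 1ℙ → N *ᴹ x ≡ M *ᴹ x +ᵛ u
  u·x≡1⇒N≡M+u {x} u·x = begin
    N *ᴹ x                     ≡⟨ ⊗-*ᴹ M u u x ⟩
    M *ᴹ x +ᵛ (u · x) *ᵛ u     ≡⟨ cong (λ a → M *ᴹ x +ᵛ a *ᵛ u) u·x ⟩
    M *ᴹ x +ᵛ 1ℙ *ᵛ u          ≡⟨ cong (M *ᴹ x +ᵛ_) (1*ᵛ u) ⟩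
    M *ᴹ x +ᵛ u                ∎

  null-u≡0 : u ≡ 0ᵛ → null N ≡ null M
  null-u≡0 u≡0 = dim-cong (Ker? N) (Ker? M)
    (λ {x} p → trans (sym (N≡M x)) p) (λ {x} p → trans (N≡M x) p)
    where
    N≡M : ∀ x → N *ᴹ x ≡ M *ᴹ x
    N≡M x = u·x≡0⇒N≡M (trans (cong (_· x) u≡0) (·-zeroˡ x))

  null-u∉Im : u ∉ Im M → null N + 1 ≡ null M
  null-u∉Im u∉Im with fredholm M u
  -- The alternative speaks of the row span, which symmetry identifies with `Im M`.
  ... | inj₁ (c , eq) = contradiction (c , trans (symmetric-*ᴹ M M-sym c) eq) u∉Im
  ... | inj₂ (z , z∈Ker , u·z) = dim-hyperplane (Ker? N) (Ker? M) u
    (λ x∈ → trans (sym (u·x≡0⇒N≡M (Ker-N⊆u⊥ x∈))) x∈)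
    Ker-N⊆u⊥
    (λ x∈ u·x → trans (u·x≡0⇒N≡M u·x) x∈)
    (Ker-+ᵛ M) z∈Ker u·z
    where
    Ker-N⊆u⊥ : ∀ {x} → x ∈ Ker N → u · x ≡ 0ℙ
    Ker-N⊆u⊥ {x} x∈ with u · x in u·x
    ... | 0ℙ = refl
    -- Here `N *ᴹ x ≡ 0ᵛ` reads `M *ᴹ x +ᵛ u ≡ 0ᵛ`, which would make `x` a preimage of `u`.
    ... | 1ℙ = contradiction
      (x , sym (+ᵛ≡0⇒≡ (M *ᴹ x) u (trans (sym (u·x≡1⇒N≡M+u u·x)) x∈))) u∉Im

  module _ (y : 𝔽₂^ n) (My≡u : M *ᴹ y ≡ u) where

    -- The pairing with `u` thus depends only on `M *ᴹ x`: it is constant on the solutions of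
    -- `M *ᴹ x ≡ u` and vanishes on `Ker M`.
    u·-adjoint : ∀ x → u · x ≡ y · (M *ᴹ x)
    u·-adjoint x = trans (cong (_· x) (sym My≡u)) (selfAdjoint M M-sym y x)

    u·y-unique : ∀ y′ → M *ᴹ y′ ≡ u → u · y ≡ u · y′
    u·y-unique y′ My′≡u = begin
      u · y           ≡⟨ ·-comm u y ⟩
      y · u           ≡⟨ cong (y ·_) My′≡u ⟨
      y · (M *ᴹ y′)   ≡⟨ u·-adjoint y′ ⟨
      u · y′          ∎

    -- The map `I + yuᵀ`: a transvection or the identity if `u · y ≡ 0ℙ`, the projection along `y`
    -- onto the orthogonal complement of `u` if `u · y ≡ 1ℙ`.
    φ : 𝔽₂^ n → 𝔽₂^ n
    φ x = x +ᵛ (u · x) *ᵛ y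

    N≡M∘φ : ∀ x → N *ᴹ x ≡ M *ᴹ φ x
    N≡M∘φ x = begin
      N *ᴹ x                              ≡⟨ ⊗-*ᴹ M u u x ⟩
      M *ᴹ x +ᵛ (u · x) *ᵛ u              ≡⟨ cong (λ w → M *ᴹ x +ᵛ (u · x) *ᵛ w) My≡u ⟨
      M *ᴹ x +ᵛ (u · x) *ᵛ (M *ᴹ y)       ≡⟨ cong (M *ᴹ x +ᵛ_) (*ᴹ-*ᵛ M (u · x) y) ⟨
      M *ᴹ x +ᵛ M *ᴹ ((u · x) *ᵛ y)       ≡⟨ *ᴹ-distribˡ-+ᵛ M x _ ⟨
      M *ᴹ φ x                            ∎

    rank-u·y≡0 : u · y ≡ 0ℙ → rank N ≡ rank M
    rank-u·y≡0 u·y = dim-cong (Im? N) (Im? M)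
      (λ { (x , eq) → φ x , trans (sym (N≡M∘φ x)) eq })
      (λ { (x , eq) → φ x , trans (N≡M∘φ (φ x)) (trans (cong (M *ᴹ_) (φ-involutive x)) eq) })
      where
      -- Since `φ` preserves the pairing with `u`, its second application adds the same multiple of
      -- `y` again, and the two cancel.
      u·φ : ∀ x → u · φ x ≡ u · x
      u·φ x = begin
        u · φ x                                ≡⟨ ·-distribˡ-+ᵛ u x _ ⟩
        (u · x) ℙ.+ (u · ((u · x) *ᵛ y))       ≡⟨ cong ((u · x) ℙ.+_) (·-*ᵛ-assoc (u · x) u y) ⟩
        (u · x) ℙ.+ ((u · x) ℙ.* (u · y))      ≡⟨ cong (λ a → (u · x) ℙ.+ ((u · x) ℙ.* a)) u·y ⟩
        (u · x) ℙ.+ ((u · x) ℙ.* 0ℙ)           ≡⟨ cong ((u · x) ℙ.+_) (ℙ.*-zeroʳ (u · x)) ⟩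
        (u · x) ℙ.+ 0ℙ                         ≡⟨ ℙ.+-identityʳ _ ⟩
        u · x                                  ∎

      φ-involutive : ∀ x → φ (φ x) ≡ x
      φ-involutive x = trans (cong (λ a → φ x +ᵛ a *ᵛ y) (u·φ x)) (+ᵛ-involutiveʳ x _)

    null-u·y≡1 : u · y ≡ 1ℙ → null M + 1 ≡ null N
    null-u·y≡1 u·y = dim-hyperplane (Ker? M) (Ker? N) u
      (λ x∈ → trans (u·x≡0⇒N≡M (Ker-M⊆u⊥ x∈)) x∈)
      Ker-M⊆u⊥
      (λ x∈ u·x → trans (sym (u·x≡0⇒N≡M u·x)) x∈)
      (Ker-+ᵛ N)
      -- The vector off the hyperplane is `y` itself: `N *ᴹ y` equals `u +ᵛ u`.
      (trans (u·x≡1⇒N≡M+u u·y) (trans (cong (_+ᵛ u) My≡u) (+ᵛ-self u)))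
      u·y
      where
      Ker-M⊆u⊥ : ∀ {x} → x ∈ Ker M → u · x ≡ 0ℙ
      Ker-M⊆u⊥ {x} x∈ = trans (u·-adjoint x) (trans (cong (y ·_) x∈) (·-zeroʳ y))

theorem1p3 : ∀ (n : ℕ) (M : Matrix n n) → Symmetric M → (u : 𝔽₂^ n) →
    (u ≡ 0ᵛ → null (M +ᴹ u ⊗ u) ≡ null M)
    ×
    (u ≢ 0ᵛ →
    (u ∉ Im M →
    null (M +ᴹ u ⊗ u) + 1 ≡ null M ×
    rank (M +ᴹ u ⊗ u) ≡ rank M + 1)
    ×
    (u ∈ Im M →
    (∀ y y′ → M *ᴹ y ≡ u → M *ᴹ y′ ≡ u → u · y ≡ u · y′)
    ×
    (∀ y → M *ᴹ y ≡ u →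
    ((u · y ≡ 0ℙ → null (M +ᴹ u ⊗ u) ≡ null M) ×
    (u · y ≡ 1ℙ → null (M +ᴹ u ⊗ u) ≡ null M + 1))
    ×
    ((u · y ≡ 0ℙ → rank (M +ᴹ u ⊗ u) ≡ rank M) ×
    (u · y ≡ 1ℙ → rank (M +ᴹ u ⊗ u) + 1 ≡ rank M)))))
theorem1p3 n M M-sym u = null-u≡0 M M-sym u , λ _ →
  (λ u∉Im →
    let eq = null-u∉Im M M-sym u u∉Im
    in eq , null+1⇒rank+1 (M +ᴹ u ⊗ u) M eq) ,
  λ _ →
  (λ y y′ My≡u → u·y-unique M M-sym u y My≡u y′) ,
  λ y My≡u →
  -- Rank-nullity is used in opposite directions: from rank to nullity for `u · y ≡ 0ℙ`, from
  -- nullity to rank for `u · y ≡ 1ℙ`.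
  let rank≡  = rank-u·y≡0 M M-sym u y My≡u
      null+1 = null-u·y≡1 M M-sym u y My≡u
  in ((λ u·y → rank≡⇒null≡ (M +ᴹ u ⊗ u) M (rank≡ u·y)) ,
      (λ u·y → sym (null+1 u·y))) ,
     (rank≡ ,
      (λ u·y → sym (null+1⇒rank+1 M (M +ᴹ u ⊗ u) (null+1 u·y))))
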